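{- Let $G$ be a graph with no isolated vertices. Then $b_{tR}(G)=1$ if and only if $G$ has an edge $uv$ such that $G-uv$ has no isolated vertices and every $\gamma_{tR}(G)$-function $f=(V_0,V_1,V_2)$ satisfies (i) $G[V_1\cup V_2]-uv$ has an isolated vertex, or (ii) $u\in V_2$ and $v\in \mathrm{epn}(u,V_2)\cap V_0$, or $v\in V_2$ and $u\in\mathrm{epn}(v,V_2)\cap V_0$.
   Context: A TRDF on $G=(V,E)$ is a function $f:V\to\{0,1,2\}$ such that every $v$ with $f(v)=0$ has a neighbor $u$ with $f(u)=2$ and the subgraph induced by $\{v:f(v)>0\}$ has no isolated vertices; $\gamma_{tR}(G)$ is its minimum weight and a $\gamma_{tR}(G)$-function is a TRDF of that weight. A function $f$ is identified with the partition $(V_0,V_1,V_2)$ where $V_i=\{v:f(v)=i\}$. $b_{tR}(G)$ is the minimum $|E'|$ such that $G-E'$ has no isolated vertices and $\gamma_{tR}(G-E')>\gamma_{tR}(G)$ ($\infty$ if none). For $S\subseteq V$ and $v\in S$, $\mathrm{epn}(v,S)=\{w\in V\setminus S: N(w)\cap S=\{v\}\}$. $G[X]$ is the induced subgraph. -}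

module Defs where

open import Data.Fin using (Fin; toℕ; _<_)
open import Data.Fin.Patterns using (0F; 2F)
open import Data.Fin.Properties using () renaming (_≟_ to _≟F_)
open import Data.List using (List; length; map; allFin)
open import Data.List.Membership.Propositional using (_∈_)
open import Data.List.Relation.Unary.All using (All)
open import Data.List.Relation.Unary.Unique.Propositional using (Unique)
open import Data.Nat using (ℕ; _≤_) renaming (_<_ to _<ℕ_)
open import Data.Nat.ListAction using (sum)
open import Data.Product using (Σ; Σ-syntax; ∃-syntax; _×_; _,_; proj₁)
open import Data.Product.Properties using (≡-dec)
open import Data.Sum using (_⊎_; swap)
open import Function using (_∘_)
open import Relation.Binary using (Rel; Decidable; Symmetric)
open import Relation.Binary.PropositionalEquality using (_≡_)
open import Relation.Nullary using (¬_; ¬?)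
open import Relation.Nullary.Construct.Add.Supremum using (_⁺; ⊤⁺; [_])
open import Relation.Nullary.Decidable using (_×-dec_; _⊎-dec_)
open import Relation.Unary using (Pred; ∁; _∩_; ｛_｝; _≐_)
open import Level using (0ℓ)
import Data.List.Membership.DecPropositional as DecMembership

-- Simple graphs. The vertex type is a parameter, so that an induced subgraph
-- can have the subtype Σ V X as its vertex type; finite graphs are the
-- instances with V = Fin n. Adjacency is decidable, as for any finite graph
-- in the classical sense.
record Graph (V : Set) : Set₁ where
  field
    Adj    : Rel V 0ℓ
    Adj?   : Decidable Adj
    sym    : Symmetric Adj
    irrefl : ∀ {v} → ¬ Adj v v

open Graph public using (Adj)

module _ {V : Set} where

  N : Graph V → V → Pred V 0ℓ
  N G v = Adj G v

  Isolated : Graph V → Pred V 0ℓ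
  Isolated G v = ∀ w → ¬ Adj G v w

  HasIsolatedVertex : Graph V → Set
  HasIsolatedVertex G = ∃[ v ] Isolated G v

  NoIsolatedVertices : Graph V → Set
  NoIsolatedVertices G = ¬ HasIsolatedVertex G

  induced : Graph V → (X : Pred V 0ℓ) → Graph (Σ V X)
  induced G X = record
    { Adj    = λ x y → Adj G (proj₁ x) (proj₁ y)
    ; Adj?   = λ x y → Graph.Adj? G (proj₁ x) (proj₁ y)
    ; sym    = Graph.sym G
    ; irrefl = Graph.irrefl G
    }

  -- Deletes every edge xy such that R x y or R y x.
  delete : Graph V → {R : Rel V 0ℓ} → Decidable R → Graph V
  delete G {R} R? = record
    { Adj    = λ x y → Adj G x y × ¬ (R x y ⊎ R y x)
    ; Adj?   = λ x y → Graph.Adj? G x y ×-dec ¬? (R? x y ⊎-dec R? y x)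
    ; sym    = λ { (a , ¬r) → Graph.sym G a , ¬r ∘ swap }
    ; irrefl = λ { (a , _) → Graph.irrefl G a }
    }

  -- External private neighbours of v with respect to S, for v in S.
  epn : Graph V → V → Pred V 0ℓ → Pred V 0ℓ
  epn G v S w = ∁ S w × (N G w ∩ S) ≐ ｛ v ｝

-- A set of edges of G: each edge is listed at most once, as the pair of its
-- endpoints in increasing order, so that the length is the number of edges.
record EdgeSet {n} (G : Graph (Fin n)) : Set where
  field
    edges    : List (Fin n × Fin n)
    areEdges : All (λ { (u , v) → u < v × Adj G u v }) edges
    unique   : Unique edges

  size : ℕ
  size = length edges

module _ {n : ℕ} where

  infixl 6 _-E_

  _-E_ : (G : Graph (Fin n)) → EdgeSet G → Graph (Fin n)
  G -E E′ = delete G {λ x y → (x , y) ∈ EdgeSet.edges E′}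
                     (λ x y → (x , y) ∈? EdgeSet.edges E′)
    where open DecMembership (≡-dec (_≟F_ {n}) _≟F_) using (_∈?_)

  deleteEdge : Graph (Fin n) → Fin n → Fin n → Graph (Fin n)
  deleteEdge G u v = delete G {λ x y → x ≡ u × y ≡ v}
                              (λ x y → (x ≟F u) ×-dec (y ≟F v))

  -- H - uv for a graph H on a subset X of the vertices; this is H itself
  -- when u or v lies outside X.
  deleteEdgeOn : {X : Pred (Fin n) 0ℓ} →
                 Graph (Σ (Fin n) X) → Fin n → Fin n → Graph (Σ (Fin n) X)
  deleteEdgeOn H u v = delete H {λ x y → proj₁ x ≡ u × proj₁ y ≡ v}
                                (λ x y → (proj₁ x ≟F u) ×-dec (proj₁ y ≟F v))

  V[_] : Fin 3 → (Fin n → Fin 3) → Pred (Fin n) 0ℓ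
  V[ i ] f v = f v ≡ i

  weight : (Fin n → Fin 3) → ℕ
  weight f = sum (map (toℕ ∘ f) (allFin n))

  record IsTRDF (G : Graph (Fin n)) (f : Fin n → Fin 3) : Set where
    field
      dominating : ∀ v → f v ≡ 0F → ∃[ u ] (Adj G v u × f u ≡ 2F)
      total      : NoIsolatedVertices (induced G (λ v → 0 <ℕ toℕ (f v)))

-- The minimum of a set of natural numbers as a relation, with ⊤⁺ (that is, ∞)
-- as the minimum of the empty set.
IsMinimum : Pred ℕ 0ℓ → ℕ ⁺ → Set
IsMinimum P ⊤⁺    = ∀ k → ¬ P k
IsMinimum P [ m ] = P m × (∀ k → P k → m ≤ k)

module _ {n : ℕ} where

  -- γtR G k means γ_tR(G) = k.
  γtR : Graph (Fin n) → ℕ → Set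
  γtR G k = IsMinimum (λ w → ∃[ f ] (IsTRDF G f × weight f ≡ w)) [ k ]

  IsγtRFunction : Graph (Fin n) → (Fin n → Fin 3) → Set
  IsγtRFunction G f = IsTRDF G f × γtR G (weight f)

  -- γtR-Less G H means γ_tR(G) < γ_tR(H).
  γtR-Less : Graph (Fin n) → Graph (Fin n) → Set
  γtR-Less G H = ∃[ k ] ∃[ l ] (γtR G k × γtR H l × k <ℕ l)

  -- btR G k means b_tR(G) = k.
  btR : Graph (Fin n) → ℕ ⁺ → Set
  btR G = IsMinimum λ k → Σ[ E′ ∈ EdgeSet G ]
    (NoIsolatedVertices (G -E E′) × γtR-Less G (G -E E′) × EdgeSet.size E′ ≡ k)

-- Write H = G − uv. Every TRDF of H is a TRDF of G, so γ_tR(G) < γ_tR(H) holds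
-- exactly when no γ_tR(G)-function is a TRDF of H. A TRDF f of G fails on H
-- either because totality breaks, which is (i), or because some vertex of V₀
-- loses its last neighbour in V₂; that vertex is then an end of uv and a private
-- neighbour of the other end, which is (ii).

{-# OPTIONS --safe #-}
module Submission where

open import Defs
open import Data.Empty using (⊥-elim)
open import Data.Fin using (Fin; toℕ; finToFun; funToFin)
open import Data.Fin.Patterns using (0F; 1F; 2F)
open import Data.Fin.Properties using (any?; all?; ¬∀⟶∃¬; <-cmp; finToFun-funToFin) renaming (_≟_ to _≟F_)
open import Data.List using (allFin; []; _∷_)
open import Data.List.Properties using (map-cong)
open import Data.List.Relation.Unary.All using ([]; _∷_)
open import Data.List.Relation.Unary.AllPairs using ([]; _∷_)
open import Data.List.Relation.Unary.Any using (here)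
open import Data.Nat using (ℕ; _≤_; z<s; s≤s; z≤n) renaming (_<_ to _<ℕ_)
open import Data.Nat.Induction using (<-wellFounded)
open import Data.Nat.ListAction using (sum)
open import Data.Nat.Properties using (_<?_; ≮⇒≥; <-≤-trans; ≤∧≢⇒<; <⇒≱)
open import Data.Product using (_×_; ∃-syntax; _,_; proj₁; proj₂)
open import Data.Sum using (_⊎_; inj₁; inj₂; [_,_]′)
open import Function using (_∘_; _∘′_)
open import Function.Bundles using (_⇔_; mk⇔)
open import Induction.WellFounded using (Acc; acc)
open import Level using (0ℓ)
open import Relation.Binary using (_⇒_; tri<; tri≈; tri>)
open import Relation.Binary.PropositionalEquality using (_≡_; _≢_; _≗_; refl; sym; trans; cong; subst)
open import Relation.Nullary using (¬_; Dec; yes; no; ¬?)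
open import Relation.Nullary.Construct.Add.Supremum using ([_])
open import Relation.Nullary.Decidable using (_×-dec_; _→-dec_; map′; decidable-stable)
open import Relation.Unary using (Pred; Decidable; _∈_; _∩_; _∪_; _⊆_)

hasIsolatedVertex-map : {V : Set} {G H : Graph V} → Adj H ⇒ Adj G →
  HasIsolatedVertex G → HasIsolatedVertex H
hasIsolatedVertex-map H⇒G (v , iso) = v , λ w → iso w ∘ H⇒G

-- The isolated vertex moves along one inclusion, its possible neighbours back along the other. This
-- lets totality, stated on `Positive f`, be compared with (i), stated on V₁ ∪ V₂.
hasIsolatedVertex-induced : {V : Set} (G : Graph V) {X Y : Pred V 0ℓ} → X ⊆ Y → Y ⊆ X →
  HasIsolatedVertex (induced G X) → HasIsolatedVertex (induced G Y)
hasIsolatedVertex-induced G X⊆Y Y⊆X ((v , x) , iso) =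
  (v , X⊆Y x) , λ (w , y) → iso (w , Y⊆X y)

module _ {n : ℕ} where

  hasIsolatedVertex-induced? : (G : Graph (Fin n)) {X : Pred (Fin n) 0ℓ} → Decidable X →
    Dec (HasIsolatedVertex (induced G X))
  hasIsolatedVertex-induced? G X? = map′
    (λ (v , x , iso) → (v , x) , λ (w , y) → iso w y)
    (λ ((v , x) , iso) → v , x , λ w y → iso (w , y))
    (any? λ v → X? v ×-dec all? λ w → X? w →-dec ¬? (Graph.Adj? G v w))

  Positive : (Fin n → Fin 3) → Pred (Fin n) 0ℓ
  Positive f v = 0 <ℕ toℕ (f v)

  positive⇒V₁∪V₂ : ∀ f → Positive f ⊆ V[ 1F ] f ∪ V[ 2F ] f
  positive⇒V₁∪V₂ f {v} p with f v
  ... | 1F = inj₁ refl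
  ... | 2F = inj₂ refl

  V₁∪V₂⇒positive : ∀ f → V[ 1F ] f ∪ V[ 2F ] f ⊆ Positive f
  V₁∪V₂⇒positive f (inj₁ e) rewrite e = z<s
  V₁∪V₂⇒positive f (inj₂ e) rewrite e = z<s

  Dominated : Graph (Fin n) → (Fin n → Fin 3) → Pred (Fin n) 0ℓ
  Dominated G f v = f v ≡ 0F → ∃[ u ] (Adj G v u × f u ≡ 2F)

  dominated? : ∀ G f → Decidable (Dominated G f)
  dominated? G f v =
    (f v ≟F 0F) →-dec any? λ u → Graph.Adj? G v u ×-dec (f u ≟F 2F)

  isTRDF? : ∀ (G : Graph (Fin n)) → Decidable (IsTRDF G)
  isTRDF? G f = map′
    (λ (d , t) → record { dominating = d ; total = t })
    (λ T → IsTRDF.dominating T , IsTRDF.total T)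
    (all? (dominated? G f)
      ×-dec ¬? (hasIsolatedVertex-induced? G λ v → 0 <? toℕ (f v)))

  isTRDF-map : ∀ {G H : Graph (Fin n)} {f} → Adj H ⇒ Adj G → IsTRDF H f → IsTRDF G f
  isTRDF-map {G} {H} {f} H⇒G T = record
    { dominating = λ v e → let u , a , e′ = IsTRDF.dominating T v e in u , H⇒G a , e′
    ; total      = IsTRDF.total T ∘′
        hasIsolatedVertex-map {G = induced G (Positive f)} {induced H (Positive f)} H⇒G
    }

  isTRDF-cong : ∀ {G : Graph (Fin n)} {f g} → f ≗ g → IsTRDF G f → IsTRDF G g
  isTRDF-cong {G} {f} {g} f≗g T = record
    { dominating = λ v e →
        let u , a , e′ = IsTRDF.dominating T v (trans (f≗g v) e) in u , a , trans (sym (f≗g u)) e′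
    ; total      = IsTRDF.total T ∘′ hasIsolatedVertex-induced G
        (λ {v} → subst (λ i → 0 <ℕ toℕ i) (sym (f≗g v)))
        (λ {v} → subst (λ i → 0 <ℕ toℕ i) (f≗g v))
    }

  weight-cong : {f g : Fin n → Fin 3} → f ≗ g → weight f ≡ weight g
  weight-cong f≗g = cong sum (map-cong (cong toℕ ∘ f≗g) (allFin n))

  isTRDF-const1 : {G : Graph (Fin n)} → NoIsolatedVertices G → IsTRDF G (λ _ → 1F)
  isTRDF-const1 noIso = record
    { dominating = λ _ ()
    ; total      = λ ((v , _) , iso) → noIso (v , λ w → iso (w , z<s))
    }

  -- Descent on the weight. `finToFun` enumerates the finitely many functions, so it is decidable
  -- whether some TRDF is lighter than `f`; if one is, the search restarts from it, and if none is,
  -- `f` is minimum.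
  isγtRFunction-below : (G : Graph (Fin n)) → ∀ f → IsTRDF G f → Acc _<ℕ_ (weight f) →
    ∃[ g ] IsγtRFunction G g
  isγtRFunction-below G f T (acc rec)
    with any? (λ i → isTRDF? G (finToFun i) ×-dec (weight (finToFun {3} {n} i) <? weight f))
  ... | yes (i , T′ , lt) = isγtRFunction-below G (finToFun i) T′ (rec lt)
  ... | no none = f , T , (f , T , refl) , λ { _ (g , T′ , refl) → ≮⇒≥ λ lt →
          -- `finToFun (funToFin g)` agrees with `g` only pointwise, so the TRDF property and the
          -- weight are both carried along `≗`.
          let g≗ = λ v → sym (finToFun-funToFin {n} {3} g v) in
          none (funToFin g , isTRDF-cong g≗ T′ , subst (_<ℕ weight f) (weight-cong g≗) lt) }

  γtR-exists : {G : Graph (Fin n)} → NoIsolatedVertices G → ∃[ k ] γtR G k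
  γtR-exists {G} noIso =
    -- The descent starts from the constant function 1, a TRDF because no vertex is isolated.
    let f , _ , min = isγtRFunction-below G _ (isTRDF-const1 noIso) (<-wellFounded _)
    in weight f , min

  -- Otherwise l ≤ `weight f` ≤ k < l, where k and l are the minimum weights for `G` and `H`.
  γtR-less⇒¬isTRDF : ∀ {G H : Graph (Fin n)} {f} → γtR-Less G H →
    IsγtRFunction G f → ¬ IsTRDF H f
  γtR-less⇒¬isTRDF (k , l , ((g , Tg , refl) , _) , (_ , l≤) , k<l) (_ , _ , f≤) T =
    <⇒≱ (<-≤-trans k<l (l≤ _ (_ , T , refl))) (f≤ _ (g , Tg , refl))

  -- A minimum TRDF `h` of `H` is also a TRDF of `G`, so k ≤ l. If k = l, then `h` is a minimum TRDF
  -- of `G` that survives in `H`, which is excluded.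
  ¬isTRDF⇒γtR-less : {G H : Graph (Fin n)} → NoIsolatedVertices G → NoIsolatedVertices H →
    Adj H ⇒ Adj G → (∀ f → IsγtRFunction G f → ¬ IsTRDF H f) → γtR-Less G H
  ¬isTRDF⇒γtR-less noIsoG noIsoH H⇒G none
    with k , γG@(_ , k≤) ← γtR-exists noIsoG
       | l , γH@((h , T , refl) , _) ← γtR-exists noIsoH
    = k , l , γG , γH , ≤∧≢⇒< (k≤ l (h , isTRDF-map H⇒G T , refl))
        λ { refl → none h (isTRDF-map H⇒G T , γG) T }

  -- Adding edges keeps a minimum TRDF of `G` a TRDF. With `H` obtained by deleting the empty edge
  -- set, this rules out a bondage number of 0.
  γtR-less-irrefl : {G H : Graph (Fin n)} → Adj G ⇒ Adj H → ¬ γtR-Less G H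
  γtR-less-irrefl G⇒H less@(k , _ , γG@((f , T , refl) , _) , _) =
    γtR-less⇒¬isTRDF less (T , γG) (isTRDF-map G⇒H T)

  module _ (G : Graph (Fin n)) where

    EdgeCritical : Fin n → Fin n → (Fin n → Fin 3) → Set
    EdgeCritical u v f =
        HasIsolatedVertex (deleteEdgeOn (induced G (V[ 1F ] f ∪ V[ 2F ] f)) u v)
      ⊎ ( (u ∈ V[ 2F ] f × v ∈ (epn G u (V[ 2F ] f) ∩ V[ 0F ] f))
        ⊎ (v ∈ V[ 2F ] f × u ∈ (epn G v (V[ 2F ] f) ∩ V[ 0F ] f)))

    -- In case (ii) the end of uv in V₀ has the other end as its only neighbour in V₂, so any vertex
    -- dominating it after the deletion would have to do so along uv itself.
    edgeCritical⇒¬isTRDF : ∀ {u v f} → EdgeCritical u v f → ¬ IsTRDF (deleteEdge G u v) f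
    -- Deleting uv and passing to an induced subgraph commute definitionally on adjacency, so `iso`
    -- also speaks of `induced (deleteEdge G u v)`.
    edgeCritical⇒¬isTRDF {u} {v} {f} (inj₁ iso) T = IsTRDF.total T
      (hasIsolatedVertex-induced (deleteEdge G u v) (V₁∪V₂⇒positive f) (positive⇒V₁∪V₂ f) iso)
    edgeCritical⇒¬isTRDF {u} {v} (inj₂ (inj₁ (_ , (_ , only , _) , v∈V₀))) T =
      let w , (a , kept) , w∈V₂ = IsTRDF.dominating T v v∈V₀
      in kept (inj₂ (sym (only (a , w∈V₂)) , refl))
    edgeCritical⇒¬isTRDF {u} {v} (inj₂ (inj₂ (_ , (_ , only , _) , u∈V₀))) T =
      let w , (a , kept) , w∈V₂ = IsTRDF.dominating T u u∈V₀
      in kept (inj₁ (refl , sym (only (a , w∈V₂))))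

    -- The last hypothesis excludes a third vertex x in V₂ next to z. It offers both x ≢ w and x ≢ z
    -- because these are what shows that the edge zx survives the deletion of zw.
    private-neighbour : ∀ {f z w} → f z ≡ 0F → f w ≡ 2F → Adj G z w →
      (∀ {x} → Adj G z x → f x ≡ 2F → x ≢ w → ¬ x ≢ z) →
      z ∈ (epn G w (V[ 2F ] f) ∩ V[ 0F ] f)
    private-neighbour {f} {z} {w} z∈V₀ w∈V₂ a none =
      ( z∉V₂
      , (λ {x} (b , x∈V₂) → sym (decidable-stable (x ≟F w)
           λ x≢w → none b x∈V₂ x≢w λ { refl → z∉V₂ x∈V₂ }))
      , λ { refl → a , w∈V₂ })
      , z∈V₀
      where
      z∉V₂ : ¬ f z ≡ 2F
      z∉V₂ e with () ← trans (sym z∈V₀) e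

    ¬isTRDF⇒edgeCritical : ∀ {u v f} → IsTRDF G f → ¬ IsTRDF (deleteEdge G u v) f →
      EdgeCritical u v f
    ¬isTRDF⇒edgeCritical {u} {v} {f} T ¬T
      with hasIsolatedVertex-induced? (deleteEdge G u v) (λ z → 0 <? toℕ (f z))
    ... | yes iso = inj₁
          (hasIsolatedVertex-induced (deleteEdge G u v) (positive⇒V₁∪V₂ f) (V₁∪V₂⇒positive f) iso)
    ... | no total
      with z , ¬dom ← ¬∀⟶∃¬ n _ (dominated? (deleteEdge G u v) f)
                        (λ dom → ¬T (record { dominating = dom ; total = total }))
      -- If f z were nonzero, domination at z would hold vacuously.
      with z∈V₀ ← decidable-stable (f z ≟F 0F) (λ z∉V₀ → ¬dom (⊥-elim ∘ z∉V₀))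
      with w , a , w∈V₂ ← IsTRDF.dominating T z z∈V₀
      -- The edge zw must be uv in one of its two orientations; otherwise w still dominates z after
      -- the deletion.
      with (z ≟F u) ×-dec (w ≟F v) | (w ≟F u) ×-dec (z ≟F v)
    ... | yes (refl , refl) | _ = inj₂ (inj₂ (w∈V₂ ,
          private-neighbour z∈V₀ w∈V₂ a λ b x∈V₂ x≢v x≢u →
            ¬dom λ _ → _ , (b , [ x≢v ∘ proj₂ , x≢u ∘ proj₁ ]′) , x∈V₂))
    ... | no _ | yes (refl , refl) = inj₂ (inj₁ (w∈V₂ ,
          private-neighbour z∈V₀ w∈V₂ a λ b x∈V₂ x≢u x≢v →
            ¬dom λ _ → _ , (b , [ x≢v ∘ proj₂ , x≢u ∘ proj₁ ]′) , x∈V₂))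
    ... | no zw≢uv | no wz≢uv =
          ⊥-elim (¬dom λ _ → w , (a , [ zw≢uv , wz≢uv ]′) , w∈V₂)

    module _ (E′ : EdgeSet G) {u v : Fin n} where

      -E⇒deleteEdge : EdgeSet.edges E′ ≡ (u , v) ∷ [] → Adj (G -E E′) ⇒ Adj (deleteEdge G u v)
      -E⇒deleteEdge refl (a , kept) = a ,
        λ { (inj₁ (refl , refl)) → kept (inj₁ (here refl))
          ; (inj₂ (refl , refl)) → kept (inj₂ (here refl)) }

      deleteEdge⇒-E : EdgeSet.edges E′ ≡ (u , v) ∷ [] → Adj (deleteEdge G u v) ⇒ Adj (G -E E′)
      deleteEdge⇒-E refl (a , kept) = a ,
        λ { (inj₁ (here refl)) → kept (inj₁ (refl , refl))
          ; (inj₂ (here refl)) → kept (inj₂ (refl , refl)) }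

    deleteEdge-comm : ∀ {u v} → Adj (deleteEdge G u v) ⇒ Adj (deleteEdge G v u)
    deleteEdge-comm (a , kept) = a , λ
      { (inj₁ (p , q)) → kept (inj₂ (q , p))
      ; (inj₂ (p , q)) → kept (inj₁ (q , p)) }

    -- An `EdgeSet` stores an edge with its smaller end first, so the list holds (u , v) or (v , u)
    -- according to the order. The two deletions are compared by inclusions of adjacency in both
    -- directions.
    edgeSet-single : ∀ {u v} → Adj G u v → ∃[ E′ ]
      (EdgeSet.size E′ ≡ 1 × Adj (G -E E′) ⇒ Adj (deleteEdge G u v)
                           × Adj (deleteEdge G u v) ⇒ Adj (G -E E′))
    edgeSet-single {u} {v} a with <-cmp u v
    ... | tri< u<v _ _ = E′ , refl , -E⇒deleteEdge E′ refl , deleteEdge⇒-E E′ refl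
      where
      E′ : EdgeSet G
      E′ = record { edges = (u , v) ∷ [] ; areEdges = (u<v , a) ∷ [] ; unique = [] ∷ [] }
    ... | tri≈ _ refl _ = ⊥-elim (Graph.irrefl G a)
    ... | tri> _ _ v<u = E′ , refl , deleteEdge-comm ∘′ -E⇒deleteEdge E′ refl
                            , deleteEdge⇒-E E′ refl ∘′ deleteEdge-comm
      where
      E′ : EdgeSet G
      E′ = record { edges = (v , u) ∷ [] ; areEdges = (v<u , Graph.sym G a) ∷ [] ; unique = [] ∷ [] }

    -E-empty : (E′ : EdgeSet G) → EdgeSet.edges E′ ≡ [] → Adj G ⇒ Adj (G -E E′)
    -E-empty E′ refl a = a , λ { (inj₁ ()) ; (inj₂ ()) }

    btR≡1⇒criticalEdge : btR G [ 1 ] → ∃[ u ] ∃[ v ]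
      (Adj G u v × NoIsolatedVertices (deleteEdge G u v)
                 × (∀ f → IsγtRFunction G f → EdgeCritical u v f))
    -- Size 1 leaves only a singleton list, and its entry is the required edge.
    btR≡1⇒criticalEdge ((E′@record { edges = (u , v) ∷ [] ; areEdges = (_ , a) ∷ [] }
                        , noIso , less , refl) , _) =
      u , v , a
      , noIso ∘′ hasIsolatedVertex-map {G = deleteEdge G u v} {G -E E′} (-E⇒deleteEdge E′ refl)
      , λ f γf → ¬isTRDF⇒edgeCritical (proj₁ γf)
          (γtR-less⇒¬isTRDF less γf ∘ isTRDF-map (deleteEdge⇒-E E′ refl))

    criticalEdge⇒btR≡1 : NoIsolatedVertices G → ∀ {u v} → Adj G u v →
      NoIsolatedVertices (deleteEdge G u v) →
      (∀ f → IsγtRFunction G f → EdgeCritical u v f) → btR G [ 1 ]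
    criticalEdge⇒btR≡1 noIsoG {u} {v} a noIso crit
      with E′ , size≡1 , E⇒uv , uv⇒E ← edgeSet-single a =
      (E′ , noIsoE , less , size≡1) , minimal
      where
      noIsoE : NoIsolatedVertices (G -E E′)
      noIsoE = noIso ∘′ hasIsolatedVertex-map {G = G -E E′} {deleteEdge G u v} uv⇒E

      less : γtR-Less G (G -E E′)
      less = ¬isTRDF⇒γtR-less noIsoG noIsoE proj₁
        λ f γf → edgeCritical⇒¬isTRDF (crit f γf) ∘ isTRDF-map E⇒uv

      minimal : ∀ k → _ → 1 ≤ k
      -- Deleting nothing cannot raise the minimum weight, so an empty edge set is impossible.
      minimal _ (E″@record { edges = [] } , _ , less″ , refl) =
        ⊥-elim (γtR-less-irrefl {H = G -E E″} (-E-empty E″ refl) less″)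
      minimal _ (record { edges = _ ∷ _ } , _ , _ , refl) = s≤s z≤n

mainTheorem13 : ∀ {n : ℕ} (G : Graph (Fin n)) → NoIsolatedVertices G →
    btR G [ 1 ] ⇔
    (∃[ u ] ∃[ v ]
    ( Adj G u v
    × NoIsolatedVertices (deleteEdge G u v)
    × (∀ (f : Fin n → Fin 3) → IsγtRFunction G f →
    HasIsolatedVertex (deleteEdgeOn (induced G (V[ 1F ] f ∪ V[ 2F ] f)) u v)
    ⊎ ( (u ∈ V[ 2F ] f × v ∈ (epn G u (V[ 2F ] f) ∩ V[ 0F ] f))
    ⊎ (v ∈ V[ 2F ] f × u ∈ (epn G v (V[ 2F ] f) ∩ V[ 0F ] f))))))
mainTheorem13 G noIso = mk⇔ (btR≡1⇒criticalEdge G)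
  λ (u , v , a , noIso′ , crit) → criticalEdge⇒btR≡1 G noIso a noIso′ crit
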